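{- For every positive integer $n$, $c_b(G_{2,n})=\left\lceil \frac{n+2}{9}\right\rceil$.
   Context: Bridge-burning Cops and Robbers is played on a finite graph $G$ by a team of cops and a single robber, with full information. First each cop chooses a starting vertex (several cops may share a vertex), then the robber chooses a starting vertex. The game then proceeds in rounds; in each round, first every cop either stays put or moves along an edge of the current graph to an adjacent vertex, and then the robber either stays put or moves along an edge of the current graph. Every edge traversed by the robber is immediately deleted from the graph (cop moves delete nothing). The cops win if at some moment some cop occupies the same vertex as the robber; the robber wins if he avoids this forever. $c_b(G)$ is the minimum number of cops for which the cops have a winning strategy. $G_{2,n}=P_n\,\Box\,P_2$ is the $2\times n$ grid (2 rows, $n$ columns). -}

module Defs where

open import Data.Nat using (ℕ; zero; suc; _+_; _<_)
open import Data.Nat.DivMod using (_/_)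
open import Data.Fin using (Fin; toℕ)
open import Data.Product using (_×_; _,_; Σ)
open import Data.Sum using (_⊎_)
open import Data.List using (List; []; _∷_)
open import Data.List.Membership.Propositional using (_∈_)
open import Data.Vec using (Vec)
open import Data.Vec.Relation.Binary.Pointwise.Inductive using (Pointwise)
import Data.Vec.Membership.Propositional as VecMem
open import Relation.Binary.PropositionalEquality using (_≡_)
open import Relation.Nullary using (¬_)

record Graph : Set₁ where
  field
    V   : Set
    Adj : V → V → Set
open Graph public

PathAdj : ∀ {m} → Fin m → Fin m → Set
PathAdj i j = (toℕ j ≡ suc (toℕ i)) ⊎ (toℕ i ≡ suc (toℕ j))

-- 2 × n grid G_{2,n} = P_n □ P_2, vertices (column, row) ∈ Fin n × Fin 2.
-- Cartesian product adjacency.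
Grid2 : ℕ → Graph
Grid2 n = record
  { V   = Fin n × Fin 2
  ; Adj = λ { (c , r) (c' , r') →
              (c ≡ c' × PathAdj r r') ⊎ (PathAdj c c' × r ≡ r') } }

module Game (G : Graph) where
  private
    W = V G
    A = Adj G

  -- Deleted edges (traversed by the robber), as ordered pairs; an edge
  -- {u,v} is deleted when (u,v) or (v,u) is in the list.
  Deleted : Set
  Deleted = List (W × W)

  Present : Deleted → W → W → Set
  Present D u v = A u v × ¬ ((u , v) ∈ D) × ¬ ((v , u) ∈ D)

  Step : Deleted → W → W → Set
  Step D u v = (u ≡ v) ⊎ Present D u v

  data RobberMove (D : Deleted) (r : W) : W → Deleted → Set where
    stay : RobberMove D r r D
    go   : ∀ {r'} → Present D r r' → RobberMove D r r' ((r , r') ∷ D)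

  -- CopsWin cs r D : it is the cops' turn, cops at cs, robber at r, edges D
  -- deleted, and the cops can force capture (inductive = every play
  -- consistent with the strategy ends in capture after finitely many rounds).
  data CopsWin {k : ℕ} : Vec W k → W → Deleted → Set where
    caught : ∀ {cs r D} → r VecMem.∈ cs → CopsWin cs r D
    move   : ∀ {cs r D} (cs' : Vec W k) →
             Pointwise (Step D) cs cs' →
             (r VecMem.∈ cs' ⊎
               (∀ r' D' → RobberMove D r r' D' → CopsWin cs' r' D')) →
             CopsWin cs r D

  CopsCanWin : ℕ → Set
  CopsCanWin k = Σ (Vec W k) λ cs → ∀ r → CopsWin cs r []

BridgeBurningCopNumber : Graph → ℕ → Set
BridgeBurningCopNumber G m =
  Game.CopsCanWin G m × (∀ k → k < m → ¬ Game.CopsCanWin G k)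

⌈_/suc_⌉ : ℕ → ℕ → ℕ
⌈ a /suc b ⌉ = (a + b) / suc b

{-# OPTIONS --safe #-}
module Submission where

-- Upper bound.  All cops start in the same row, in columns 3, 12, 21, … (counted from 0; those beyond
-- the grid stand in the last column).  So the robber starts either at most three columns away from an
-- end of the grid, next to a single cop, or in a gap of at most eight columns between two cops.  In
-- such a window the one or two cops win a finite game, which is settled by search, unless the robber
-- slips past a cop.  He can do so only by running along a row whose continuation is untouched, with his
-- way back burnt and a cop abreast of him in the other row; he is then caught at the end of the grid.
--
-- Lower bound.  The robber keeps track of the cells that no cop can have reached.  If four columns at
-- an end of the grid and one cell of the fifth are free of cops, or nine consecutive columns and one
-- cell of the tenth, then a fixed walk burns all edges at some cell and ends there before any cop can
-- interfere.  If there is no such place, then a column with one cop accounts for at most four columns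
-- on either side, and one with cops in both cells for at most five, where one column is lost at each
-- end of the grid; hence n ≤ 9 k - 2.

open import Defs
open import Data.Bool using (Bool; true; false; T; T?)
open import Data.Empty using (⊥-elim)
open import Data.Fin as Fin
  using (Fin; zero; suc; toℕ; opposite; fromℕ; fromℕ<; cast; _↑ˡ_; _↑ʳ_; #_)
open import Data.Fin.Properties as Fin
  using (toℕ-injective; toℕ<n; toℕ-cast; toℕ-↑ˡ; toℕ-↑ʳ; toℕ-fromℕ; toℕ-fromℕ<; opposite-prop; opposite-involutive; all?)
open import Data.List as List using (List; []; _∷_; _++_; head; mapMaybe; cartesianProduct; allFin; filter)
import Data.List.Membership.DecPropositional as ListDec
open import Data.List.Membership.Propositional using (_∈_)
open import Data.List.Membership.Propositional.Properties using (∈-map⁻; ∈-map⁺; ∈-filter⁻)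
open import Data.List.Relation.Unary.All as All using (All; []; _∷_)
import Data.List.Relation.Unary.All.Properties as All
open import Data.List.Relation.Unary.Any using (here; there)
open import Data.Maybe as Maybe using (Maybe; just; nothing; _<∣>_; to-witness-T)
open import Data.Nat
open import Data.Nat.DivMod using (m≡m%n+[m/n]*n; m%n<n; m/n*n≤m)
open import Data.Nat.Properties
open import Data.Nat.Tactic.RingSolver using (solve-∀)
open import Data.Product as Product using (_×_; _,_; ∃; proj₁; proj₂)
open import Data.Product.Properties using (≡-dec)
open import Data.Sum as Sum using (_⊎_; inj₁; inj₂; swap)
open import Data.Vec as Vec using (Vec; []; _∷_; count)
import Data.Vec.Membership.DecPropositional as VecDec
import Data.Vec.Membership.Propositional as Vec
import Data.Vec.Membership.Propositional.Properties as Vec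
open import Data.Vec.Properties using (count≤n)
open import Data.Vec.Relation.Binary.Pointwise.Inductive using (Pointwise; []; _∷_)
open import Data.Vec.Relation.Unary.Any using (here; there)
open import Function using (_∘_)
open import Relation.Binary.PropositionalEquality
open import Relation.Nullary
open import Relation.Nullary.Decidable using (_×-dec_; _⊎-dec_; _→-dec_; ¬?; dec⇒maybe)

-- Columns as seen by a runner in either direction.

data Direction : Set where
  leftward rightward : Direction

reverse : Direction → Direction
reverse leftward  = rightward
reverse rightward = leftward

-- The distance from the end of the grid that a runner in direction d leaves behind.
height : ∀ {m} → Direction → Fin m → ℕ
height leftward  i = toℕ (opposite i)
height rightward i = toℕ i

Behind : ∀ {m} → Direction → Fin m → Fin m → Set
Behind d i j = height d i ≡ suc (height d j)

height<n : ∀ {m} d (i : Fin m) → height d i < m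
height<n leftward  i = toℕ<n (opposite i)
height<n rightward i = toℕ<n i

height-injective : ∀ {m} d {i j : Fin m} → height d i ≡ height d j → i ≡ j
height-injective leftward  eq =
  trans (sym (opposite-involutive _)) (trans (cong opposite (toℕ-injective eq)) (opposite-involutive _))
height-injective rightward eq = toℕ-injective eq

height-surjective : ∀ {m} d {x} → x < m → ∃ λ (i : Fin m) → height d i ≡ x
height-surjective leftward x<m =
  opposite (fromℕ< x<m) , trans (cong toℕ (opposite-involutive _)) (toℕ-fromℕ< x<m)
height-surjective rightward x<m = fromℕ< x<m , toℕ-fromℕ< x<m

opposite-+ : ∀ {m} (i : Fin m) → toℕ (opposite i) + suc (toℕ i) ≡ m
opposite-+ i = trans (cong (_+ suc (toℕ i)) (opposite-prop i)) (m∸n+n≡m (toℕ<n i))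

opposite-behind : ∀ {m} {i j : Fin m} → Behind rightward i j → Behind leftward j i
opposite-behind {_} {i} {j} eq = +-cancelʳ-≡ (suc (toℕ j)) _ _ (begin
  toℕ (opposite j) + suc (toℕ j)        ≡⟨ opposite-+ j ⟩
  _                                     ≡⟨ opposite-+ i ⟨
  toℕ (opposite i) + suc (toℕ i)        ≡⟨ cong (λ x → toℕ (opposite i) + suc x) eq ⟩
  toℕ (opposite i) + suc (suc (toℕ j))  ≡⟨ +-suc (toℕ (opposite i)) _ ⟩
  suc (toℕ (opposite i)) + suc (toℕ j)  ∎)
  where open ≡-Reasoning

behind-reverse : ∀ {m} d {i j : Fin m} → Behind d i j → Behind (reverse d) j i
behind-reverse rightward b = opposite-behind b
behind-reverse leftward  b =
  subst₂ (λ i j → toℕ i ≡ suc (toℕ j)) (opposite-involutive _) (opposite-involutive _) (opposite-behind b)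

adjacent⇒behind : ∀ {m} d {i j : Fin m} → PathAdj i j → Behind d j i ⊎ Behind d i j
adjacent⇒behind rightward         a        = a
adjacent⇒behind leftward (inj₁ b) = inj₂ (behind-reverse rightward b)
adjacent⇒behind leftward (inj₂ b) = inj₁ (behind-reverse rightward b)

-- Cells of the grid and decidable presence of edges.

Cell : ℕ → Set
Cell m = Fin m × Fin 2

module _ {m : ℕ} where
  open Game (Grid2 m)

  _≟ᶜ_ : (u v : Cell m) → Dec (u ≡ v)
  _≟ᶜ_ = ≡-dec Fin._≟_ Fin._≟_

  open ListDec (≡-dec _≟ᶜ_ _≟ᶜ_) using () renaming (_∈?_ to _∈ᴱ?_) public

  pathAdj? : ∀ {k} (i j : Fin k) → Dec (PathAdj i j)
  pathAdj? i j = (toℕ j ≟ suc (toℕ i)) ⊎-dec (toℕ i ≟ suc (toℕ j))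

  present? : ∀ D (u v : Cell m) → Dec (Present D u v)
  present? D u@(i , ρ) v@(j , σ) =
    ((i Fin.≟ j ×-dec pathAdj? ρ σ) ⊎-dec (pathAdj? i j ×-dec ρ Fin.≟ σ))
    ×-dec ¬? ((u , v) ∈ᴱ? D) ×-dec ¬? ((v , u) ∈ᴱ? D)

  present-sym : ∀ {D} {u v : Cell m} → Present D u v → Present D v u
  present-sym (inj₁ (eq , a) , p , q) = inj₁ (sym eq , swap a) , q , p
  present-sym (inj₂ (a , eq) , p , q) = inj₂ (swap a , sym eq) , q , p

-- Adding cops to a team.

infix 4 _⊑_
-- Order is kept because the moves of a team are related position by position.
data _⊑_ {A : Set} : ∀ {j k} → Vec A j → Vec A k → Set where
  []   : [] ⊑ []
  keep : ∀ {j k x} {xs : Vec A j} {ys : Vec A k} → xs ⊑ ys → x ∷ xs ⊑ x ∷ ys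
  skip : ∀ {j k y} {xs : Vec A j} {ys : Vec A k} → xs ⊑ ys → xs ⊑ y ∷ ys

[]⊑ : ∀ {A : Set} {k} (ys : Vec A k) → [] ⊑ ys
[]⊑ []       = []
[]⊑ (y ∷ ys) = skip ([]⊑ ys)

⊑-refl : ∀ {A : Set} {k} (ys : Vec A k) → ys ⊑ ys
⊑-refl []       = []
⊑-refl (y ∷ ys) = keep (⊑-refl ys)

∈⇒⊑ : ∀ {A : Set} {k} {x} {ys : Vec A k} → x Vec.∈ ys → x ∷ [] ⊑ ys
∈⇒⊑ (here refl) = keep ([]⊑ _)
∈⇒⊑ (there p)   = skip (∈⇒⊑ p)

⊑⇒⊆ : ∀ {A : Set} {j k x} {xs : Vec A j} {ys : Vec A k} → xs ⊑ ys → x Vec.∈ xs → x Vec.∈ ys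
⊑⇒⊆ (keep s) (here eq) = here eq
⊑⇒⊆ (keep s) (there p) = there (⊑⇒⊆ s p)
⊑⇒⊆ (skip s) p         = there (⊑⇒⊆ s p)

module Cops (G : Graph) where
  open Game G

  -- The cops outside the smaller team stand still.
  extend-steps : ∀ {j k D} {ds ds′ : Vec (V G) j} {cs : Vec (V G) k} → ds ⊑ cs → Pointwise (Step D) ds ds′ →
                 ∃ λ (cs′ : Vec (V G) k) → Pointwise (Step D) cs cs′ × ds′ ⊑ cs′
  extend-steps []       []        = [] , [] , []
  extend-steps (keep s) (st ∷ sts) with extend-steps s sts
  ... | cs′ , sts′ , s′ = _ ∷ cs′ , st ∷ sts′ , keep s′
  extend-steps (skip s) sts with extend-steps s sts
  ... | cs′ , sts′ , s′ = _ ∷ cs′ , inj₁ refl ∷ sts′ , skip s′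

  more-cops : ∀ {j k r D} {ds : Vec (V G) j} {cs : Vec (V G) k} → ds ⊑ cs → CopsWin ds r D → CopsWin cs r D
  more-cops s (caught p) = caught (⊑⇒⊆ s p)
  more-cops s (move ds′ sts outcome) with extend-steps s sts
  more-cops s (move ds′ sts (inj₁ p)) | cs′ , sts′ , s′ = move cs′ sts′ (inj₁ (⊑⇒⊆ s′ p))
  more-cops s (move ds′ sts (inj₂ w)) | cs′ , sts′ , s′ =
    move cs′ sts′ (inj₂ λ r′ D′ rm → more-cops s′ (w r′ D′ rm))

  origin : ∀ {k D v} {cs cs′ : Vec (V G) k} → Pointwise (Step D) cs cs′ → v Vec.∈ cs′ →
           ∃ λ c → c Vec.∈ cs × Step D c v
  origin (st ∷ sts) (here refl) = _ , here refl , st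
  origin (st ∷ sts) (there p) with origin sts p
  ... | c , c∈ , st′ = c , there c∈ , st′

-- Running abreast of the robber to the end of the grid.

module _ {m : ℕ} where
  open Game (Grid2 m)

  -- Edges leading back from column `i` may be burnt; the rung at `i` and everything ahead are
  -- intact.
  Fresh : Direction → Fin m → Deleted → Set
  Fresh d i = All λ ((u , _) , (v , _)) → height d u < height d i ⊎ height d v < height d i

  Cut : Direction → Cell m → Deleted → Set
  Cut d (i , ρ) D = ∀ j → Behind d i j → ¬ Present D (i , ρ) (j , ρ)

  present-ahead : ∀ {d i D u v} → Fresh d i D → Adj (Grid2 m) u v →
                  height d i ≤ height d (proj₁ u) → height d i ≤ height d (proj₁ v) → Present D u v
  present-ahead {d} {i} fresh a i≤u i≤v = a , unburnt i≤u i≤v , unburnt i≤v i≤u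
    where
    unburnt : ∀ {u v} → height d i ≤ height d (proj₁ u) → height d i ≤ height d (proj₁ v) → ¬ (u , v) ∈ _
    unburnt i≤u i≤v p with All.lookup fresh p
    ... | inj₁ u<i = <⇒≱ u<i i≤u
    ... | inj₂ v<i = <⇒≱ v<i i≤v

  rung : ∀ (ρ : Fin 2) → PathAdj (opposite ρ) ρ
  rung zero       = inj₂ refl
  rung (suc zero) = inj₁ refl

  across : ∀ {ρ σ : Fin 2} → PathAdj ρ σ → σ ≡ opposite ρ
  across {zero}     {zero}     (inj₁ ())
  across {zero}     {zero}     (inj₂ ())
  across {zero}     {suc zero} _ = refl
  across {suc zero} {zero}     _ = refl
  across {suc zero} {suc zero} (inj₁ ())
  across {suc zero} {suc zero} (inj₂ ())

  -- N bounds the distance that is left to run.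
  chase : ∀ {d} N {i ρ D} → m ≤ N + height d i → Fresh d i D → Cut d (i , ρ) D →
          ∀ r′ D′ → RobberMove D (i , ρ) r′ D′ → CopsWin ((i , opposite ρ) ∷ []) r′ D′
  chase {d} N {i} {ρ} far fresh cut _ _ stay =
    move ((i , ρ) ∷ []) (inj₂ (present-ahead {d} {i} fresh (inj₁ (refl , rung ρ)) ≤-refl ≤-refl) ∷ []) (inj₁ (here refl))
  chase N {i} {ρ} far fresh cut (_ , σ) _ (go (inj₁ (refl , a) , _)) = caught (here (cong (i ,_) (across a)))
  chase {d} N {i} {ρ} far fresh cut (j , _) D′ (go p@(inj₂ (a , refl) , unburnt)) with adjacent⇒behind d a
  ... | inj₂ j-behind = ⊥-elim (cut j j-behind p)
  chase {d} zero {i} far fresh cut (j , _) D′ (go p@(inj₂ (a , refl) , unburnt)) | inj₁ i-behind =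
    ⊥-elim (<⇒≱ (height<n d i) far)
  chase {d} (suc N) {i} {ρ} {D} far fresh cut (j , _) D′ (go p@(inj₂ (a , refl) , unburnt)) | inj₁ i-behind =
    -- The cop follows in the other row; the edge burnt last lies in the robber's row, so the
    -- parallel edge is still there.
    move ((j , opposite ρ) ∷ [])
      (inj₂ (parallel (present-ahead {d} {i} fresh (inj₂ (a , refl)) ≤-refl (<⇒≤ i<j))) ∷ [])
      (inj₂ (chase {d} N {j} (≤-trans far (≤-reflexive (trans (sym (+-suc N _)) (cong (N +_) (sym i-behind)))))
                     (inj₁ i<j ∷ All.map (λ { (inj₁ lt) → inj₁ (<-trans lt i<j)
                                            ; (inj₂ lt) → inj₂ (<-trans lt i<j) }) fresh)
                     burnt))
    where
    other-row : ∀ σ → σ ≢ opposite σ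
    other-row zero       ()
    other-row (suc zero) ()

    parallel : Present D (i , opposite ρ) (j , opposite ρ) →
               Present (((i , ρ) , (j , ρ)) ∷ D) (i , opposite ρ) (j , opposite ρ)
    parallel (adj , ∉D , ∉D′) = adj
      , (λ { (here eq) → other-row ρ (sym (cong (proj₂ ∘ proj₁) eq)) ; (there p) → ∉D p })
      , (λ { (here eq) → other-row ρ (sym (cong (proj₂ ∘ proj₁) eq)) ; (there p) → ∉D′ p })

    i<j : height d i < height d j
    i<j = ≤-reflexive (sym i-behind)

    burnt : Cut d (j , ρ) (((i , ρ) , (j , ρ)) ∷ D)
    -- The only column behind `j` is `i`, and the edge to it in the robber's row is the one just
    -- burnt.
    burnt k k-behind (_ , _ , ∉D)
      with refl ← height-injective d {i} {k} (suc-injective (trans (sym i-behind) k-behind)) = ∉D (here refl)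

-- Cop wins confined to a window, and the search for them.

-- For a window of consecutive columns: closed d says that the window end where height d vanishes is
-- an end of the whole grid.
Closed : Set
Closed = Direction → Bool

-- From such a column every edge of the whole grid stays in the window.
Interior : ∀ {m} → Closed → Fin m → Set
Interior closed i = ∀ d → height d i ≡ 0 → T (closed d)

interior? : ∀ {m} closed (i : Fin m) → Dec (Interior closed i)
interior? closed i with back leftward | back rightward
  where
  back : ∀ d → Dec (height d i ≡ 0 → T (closed d))
  back d = (height d i ≟ 0) →-dec T? (closed d)
... | yes l | yes r = yes λ { leftward → l ; rightward → r }
... | no ¬l | _     = no λ int → ¬l (int leftward)
... | yes _ | no ¬r = no λ int → ¬r (int rightward)

module _ {m : ℕ} (closed : Closed) where
  open Game (Grid2 m)

  -- The condition on `closed` excludes an open end behind the robber: there the edge back leaves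
  -- the window, and `Cut`, which sees only the window, would hold vacuously.
  Chase : ∀ {k} → Vec (Cell m) k → Cell m → Deleted → Direction → Set
  Chase cs (i , ρ) D d =
    (i , opposite ρ) Vec.∈ cs × (height d i ≡ 0 → T (closed d)) × Fresh d i D × Cut d (i , ρ) D

  -- A cop win during which the robber never gets to move from an open end column of the window, other
  -- than into a chase.
  data Confined {k} : Vec (Cell m) k → Cell m → Deleted → Set where
    move : ∀ {cs r D} (cs′ : Vec (Cell m) k) → Pointwise (Step D) cs cs′ →
           (r Vec.∈ cs′ ⊎ ∃ (Chase cs′ r D) ⊎
             (Interior closed (proj₁ r) × (∀ r′ D′ → RobberMove D r r′ D′ → Confined cs′ r′ D′))) →
           Confined cs r D

  chase? : ∀ {k} (cs : Vec (Cell m) k) r D d → Dec (Chase cs r D d)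
  chase? cs (i , ρ) D d =
    ((i , opposite ρ) ∈ᶜ? cs)
    ×-dec ((height d i ≟ 0) →-dec T? (closed d))
    ×-dec All.all? (λ ((u , _) , (v , _)) → (height d u <? height d i) ⊎-dec (height d v <? height d i)) D
    ×-dec all? (λ j → (height d i ≟ suc (height d j)) →-dec ¬? (present? D (i , ρ) (j , ρ)))
    where open VecDec (_≟ᶜ_ {m}) using () renaming (_∈?_ to _∈ᶜ?_)

everywhere : ∀ {n} {P : Fin n → Set} → (∀ i → Maybe (P i)) → Maybe (∀ i → P i)
everywhere {zero}  f = just λ ()
everywhere {suc n} f = Maybe.zipWith (λ { p ps zero → p ; p ps (suc i) → ps i }) (f zero) (everywhere (f ∘ suc))

approach : ∀ {m} → Fin m → Fin m → Fin m
approach zero          zero          = zero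
approach {suc (suc m)} zero (suc j)  = suc zero
approach (suc i)       zero          = Fin.inject₁ i
approach (suc i)       (suc j)       = suc (approach i j)

module Search {m : ℕ} (closed : Closed) where
  open Game (Grid2 m)
  open VecDec (_≟ᶜ_ {m}) using () renaming (_∈?_ to _∈ᶜ?_)

  Reply : Deleted → Cell m → Set
  Reply D c = ∃ λ c′ → Step D c c′

  stand : ∀ {D} c → Reply D c
  stand c = c , inj₁ refl

  walk : ∀ D c → Cell m → Maybe (Reply D c)
  walk D c c′ = Maybe.map (λ p → c′ , inj₂ p) (dec⇒maybe (present? D c c′))

  -- Only moves towards the robber's column, changes of row and waiting are tried, in this order.
  replies : ∀ D → Cell m → (c : Cell m) → List (Reply D c)
  replies D (j , σ) c@(i , ρ) =
    mapMaybe (walk D c) ((approach i j , ρ) ∷ (i , opposite ρ) ∷ []) ++ stand c ∷ []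

  team-replies : ∀ {k} D → Cell m → (cs : Vec (Cell m) k) → List (∃ λ (cs′ : Vec (Cell m) k) → Pointwise (Step D) cs cs′)
  team-replies D r []       = ([] , []) ∷ []
  team-replies D r (c ∷ cs) =
    List.cartesianProductWith (λ (c′ , st) (cs′ , sts) → c′ ∷ cs′ , st ∷ sts) (replies D r c) (team-replies D r cs)

  -- A result carries its own proof, so bounding the rounds and restricting the replies can only
  -- make the search miss a win.
  search : ∀ {k} → ℕ → (cs : Vec (Cell m) k) → ∀ r D → Maybe (Confined closed cs r D)
  search zero    cs r D = nothing
  search (suc T) cs r D = head (mapMaybe (λ (cs′ , sts) → Maybe.map (move cs′ sts) (outcome cs′)) (team-replies D r cs))
    where
    robber-turn : ∀ cs′ → Maybe (∀ r′ D′ → RobberMove D r r′ D′ → Confined closed cs′ r′ D′)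
    robber-turn cs′ = Maybe.zipWith
      (λ { c cs r′ D′ stay → c ; c cs (i , ρ) D′ (go p) → cs i ρ p })
      (search T cs′ r D)
      (everywhere λ i → everywhere λ ρ → after i ρ (present? D r (i , ρ)))
      where
      after : ∀ i ρ → Dec (Present D r (i , ρ)) → Maybe (Present D r (i , ρ) → Confined closed cs′ (i , ρ) ((r , (i , ρ)) ∷ D))
      after i ρ (no ¬p) = just λ p → ⊥-elim (¬p p)
      after i ρ (yes p) = Maybe.map (λ c _ → c) (search T cs′ (i , ρ) ((r , (i , ρ)) ∷ D))

    outcome : ∀ cs′ → Maybe (r Vec.∈ cs′ ⊎ ∃ (Chase closed cs′ r D) ⊎
                (Interior closed (proj₁ r) × (∀ r′ D′ → RobberMove D r r′ D′ → Confined closed cs′ r′ D′)))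
    outcome cs′ =
      Maybe.map inj₁ (dec⇒maybe (r ∈ᶜ? cs′))
      <∣> Maybe.map (inj₂ ∘ inj₁) (Maybe.map (leftward ,_) (dec⇒maybe (chase? closed cs′ r D leftward))
                                  <∣> Maybe.map (rightward ,_) (dec⇒maybe (chase? closed cs′ r D rightward)))
      <∣> Maybe.map (inj₂ ∘ inj₂) (Maybe.zipWith _,_ (dec⇒maybe (interior? closed (proj₁ r))) (robber-turn cs′))

  -- Eight rounds suffice for all the windows below.
  search-all : ∀ {k} → (cs : Vec (Cell m) k) → Maybe (∀ i ρ → Confined closed cs (i , ρ) [])
  search-all cs = everywhere λ i → everywhere λ ρ → search 8 cs (i , ρ) []

open-ended : Closed
open-ended _ = false

open-ended-flush : ∀ {f : Direction → ℕ} d → T (open-ended d) → f d ≡ 0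
open-ended-flush _ ()

-- The runner's direction points away from the closed end: `closed-behind rightward` describes a
-- window at the left end of the grid.
closed-behind : Direction → Closed
closed-behind leftward  leftward  = true
closed-behind rightward rightward = true
closed-behind _         _         = false

closed-behind-flush : ∀ e {f : Direction → ℕ} → f e ≡ 0 → ∀ d → T (closed-behind e d) → f d ≡ 0
closed-behind-flush leftward  eq leftward  _ = eq
closed-behind-flush rightward eq rightward _ = eq

-- Here `g` counts the columns strictly between the two cops, at most eight. The search is run by
-- the type checker.
gap-confined : ∀ (g : Fin 9) i ρ →
  Confined {suc (suc (toℕ g))} open-ended ((zero , zero) ∷ (fromℕ _ , zero) ∷ []) (i , ρ) []
gap-confined = to-witness-T (everywhere λ g → Search.search-all open-ended _) _

-- Here `e` counts the columns between the cop and the end of the grid, at most three; the window is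
-- open at the cop's own column.
left-confined : ∀ (e : Fin 4) i ρ →
  Confined {suc (toℕ e)} (closed-behind rightward) ((fromℕ _ , zero) ∷ []) (i , ρ) []
left-confined = to-witness-T (everywhere λ e → Search.search-all (closed-behind rightward) _) _

right-confined : ∀ (e : Fin 4) i ρ →
  Confined {suc (toℕ e)} (closed-behind leftward) ((zero , zero) ∷ []) (i , ρ) []
right-confined = to-witness-T (everywhere λ e → Search.search-all (closed-behind leftward) _) _

-- Transfer of the game from a window to the grid.

module Window {n W : ℕ} (a b : ℕ) (fits : a + (W + b) ≡ n) where
  module Inner = Game (Grid2 W)
  module Outer = Game (Grid2 n)

  column : Fin W → Fin n
  column i = cast fits (a ↑ʳ (i ↑ˡ b))

  toℕ-column : ∀ i → toℕ (column i) ≡ a + toℕ i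
  toℕ-column i = trans (toℕ-cast fits (a ↑ʳ (i ↑ˡ b))) (trans (toℕ-↑ʳ a (i ↑ˡ b)) (cong (a +_) (toℕ-↑ˡ i b)))

  -- The number of columns of the grid beyond the end of the window where height d vanishes.
  margin : Direction → ℕ
  margin leftward  = b
  margin rightward = a

  height-column : ∀ d i → height d (column i) ≡ margin d + height d i
  height-column rightward i = toℕ-column i
  height-column leftward  i = +-cancelʳ-≡ (suc (toℕ (column i))) _ _ (begin
    toℕ (opposite (column i)) + suc (toℕ (column i))  ≡⟨ opposite-+ (column i) ⟩
    n                                                 ≡⟨ fits ⟨
    a + (W + b)                                       ≡⟨ cong (λ x → a + (x + b)) (opposite-+ i) ⟨
    a + (toℕ (opposite i) + suc (toℕ i) + b)          ≡⟨ rearrange a b (toℕ (opposite i)) (toℕ i) ⟩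
    b + toℕ (opposite i) + suc (a + toℕ i)            ≡⟨ cong (λ x → b + toℕ (opposite i) + suc x) (toℕ-column i) ⟨
    b + toℕ (opposite i) + suc (toℕ (column i))       ∎)
    where
    open ≡-Reasoning
    rearrange : ∀ a b x y → a + (x + suc y + b) ≡ b + x + suc (a + y)
    rearrange = solve-∀

  column-injective : ∀ {i j} → column i ≡ column j → i ≡ j
  column-injective {i} {j} eq = toℕ-injective (+-cancelˡ-≡ a _ _
    (trans (sym (toℕ-column i)) (trans (cong toℕ eq) (toℕ-column j))))

  column-surjective : ∀ {x} → a ≤ toℕ x → toℕ x < a + W → ∃ λ i → x ≡ column i
  column-surjective {x} a≤x x<a+W with m≤n⇒∃[o]m+o≡n a≤x
  ... | o , a+o≡x = fromℕ< o<W , toℕ-injective (trans (sym a+o≡x)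
          (sym (trans (toℕ-column _) (cong (a +_) (toℕ-fromℕ< o<W)))))
    where
    o<W : o < W
    o<W = +-cancelˡ-< a o W (subst (_< a + W) (sym a+o≡x) x<a+W)

  cell : Cell W → Cell n
  cell (i , ρ) = column i , ρ

  cell-injective : ∀ {u v} → cell u ≡ cell v → u ≡ v
  cell-injective eq = cong₂ _,_ (column-injective (cong proj₁ eq)) (cong proj₂ eq)

  edge : Cell W × Cell W → Cell n × Cell n
  edge (u , v) = cell u , cell v

  pathAdj⁺ : ∀ {i j} → PathAdj i j → PathAdj (column i) (column j)
  pathAdj⁺ {i} {j} = Sum.map (raise i j) (raise j i)
    where
    raise : ∀ i j → toℕ j ≡ suc (toℕ i) → toℕ (column j) ≡ suc (toℕ (column i))
    raise i j eq rewrite toℕ-column i | toℕ-column j | eq = +-suc a (toℕ i)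

  pathAdj⁻ : ∀ {i j} → PathAdj (column i) (column j) → PathAdj i j
  pathAdj⁻ {i} {j} = Sum.map (lower i j) (lower j i)
    where
    lower : ∀ i j → toℕ (column j) ≡ suc (toℕ (column i)) → toℕ j ≡ suc (toℕ i)
    lower i j eq rewrite toℕ-column i | toℕ-column j = +-cancelˡ-≡ a _ _ (trans eq (sym (+-suc a (toℕ i))))

  ∈-edges⁻ : ∀ {D u v} → (cell u , cell v) ∈ List.map edge D → (u , v) ∈ D
  ∈-edges⁻ {D} p with ∈-map⁻ edge p
  ... | _ , q , eq = subst (_∈ D)
          (sym (cong₂ _,_ (cell-injective (cong proj₁ eq)) (cell-injective (cong proj₂ eq)))) q

  -- Cop moves are carried out to the grid this way; the converse brings the robber's moves back
  -- into the window.
  present⁺ : ∀ {D u v} → Inner.Present D u v → Outer.Present (List.map edge D) (cell u) (cell v)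
  present⁺ (adj , p , q) = Sum.map (Product.map₁ (cong column)) (Product.map₁ pathAdj⁺) adj , p ∘ ∈-edges⁻ , q ∘ ∈-edges⁻

  present⁻ : ∀ {D u v} → Outer.Present (List.map edge D) (cell u) (cell v) → Inner.Present D u v
  present⁻ (adj , p , q) =
    Sum.map (Product.map₁ column-injective) (Product.map₁ pathAdj⁻) adj , p ∘ ∈-map⁺ edge , q ∘ ∈-map⁺ edge

  step⁺ : ∀ {D u v} → Inner.Step D u v → Outer.Step (List.map edge D) (cell u) (cell v)
  step⁺ = Sum.map (cong cell) present⁺

  steps⁺ : ∀ {k D} {cs cs′ : Vec (Cell W) k} → Pointwise (Inner.Step D) cs cs′ →
           Pointwise (Outer.Step (List.map edge D)) (Vec.map cell cs) (Vec.map cell cs′)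
  steps⁺ []         = []
  steps⁺ (st ∷ sts) = step⁺ st ∷ steps⁺ sts

  module _ (closed : Closed) (flush : ∀ d → T (closed d) → margin d ≡ 0) where

    -- Only at an end of the window could the column behind lie outside it; by `end` and `flush`
    -- such an end is an end of the grid, with no column behind.
    behind⁻ : ∀ d {i x} → (height d i ≡ 0 → T (closed d)) → Behind d (column i) x →
              ∃ λ j → x ≡ column j × Behind d i j
    behind⁻ d {i} {x} end b with height d i in eq
    ... | zero = ⊥-elim (0≢1+n (begin
          0                        ≡⟨ flush d (end refl) ⟨
          margin d                 ≡⟨ +-identityʳ _ ⟨
          margin d + 0             ≡⟨ cong (margin d +_) eq ⟨
          margin d + height d i    ≡⟨ height-column d i ⟨
          height d (column i)      ≡⟨ b ⟩
          suc (height d x)         ∎))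
      where open ≡-Reasoning
    ... | suc h with height-surjective {W} d {h} (<-trans (n<1+n h) (subst (_< W) eq (height<n d i)))
    ... | j , refl = j , height-injective d (suc-injective (begin
          suc (height d x)             ≡⟨ b ⟨
          height d (column i)          ≡⟨ height-column d i ⟩
          margin d + height d i        ≡⟨ cong (margin d +_) eq ⟩
          margin d + suc (height d j)  ≡⟨ +-suc _ _ ⟩
          suc (margin d + height d j)  ≡⟨ cong suc (height-column d j) ⟨
          suc (height d (column j))    ∎)) , refl
      where open ≡-Reasoning

    adjacent⁻ : ∀ {u v} → Interior closed (proj₁ u) → Adj (Grid2 n) (cell u) v → ∃ λ w → v ≡ cell w
    adjacent⁻ int (inj₁ (refl , _)) = _ , refl
    adjacent⁻ int (inj₂ (inj₁ b , refl)) with behind⁻ leftward (int leftward) (behind-reverse rightward b)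
    ... | j , eq , _ = (j , _) , cong (_, _) eq
    adjacent⁻ int (inj₂ (inj₂ b , refl)) with behind⁻ rightward (int rightward) b
    ... | j , eq , _ = (j , _) , cong (_, _) eq

    -- The window strategy is copied until a capture or a chase. A chase is continued on the whole
    -- grid by the one cop abreast of the robber: all burnt edges come from the window, so the grid
    -- beyond it is fresh.
    confined⇒cops-win : ∀ {k r D} {cs : Vec (Cell W) k} → Confined closed cs r D →
                        Outer.CopsWin (Vec.map cell cs) (cell r) (List.map edge D)
    confined⇒cops-win (move cs′ sts (inj₁ p)) =
      Outer.move (Vec.map cell cs′) (steps⁺ sts) (inj₁ (Vec.∈-map⁺ cell p))
    confined⇒cops-win {r = i , ρ} {D} (move cs′ sts (inj₂ (inj₁ (d , p , end , fresh , cut)))) =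
      Outer.move (Vec.map cell cs′) (steps⁺ sts) (inj₂ λ r′ D′ rm →
        Cops.more-cops (Grid2 n) (∈⇒⊑ (Vec.∈-map⁺ cell p))
          (chase {d = d} n (m≤m+n n _) fresh⁺ cut⁺ r′ D′ rm))
      where
      raise : ∀ j → height d j < height d i → height d (column j) < height d (column i)
      raise j lt = subst₂ _<_ (sym (height-column d j)) (sym (height-column d i)) (+-monoʳ-< (margin d) lt)

      fresh⁺ : Fresh d (column i) (List.map edge D)
      fresh⁺ = All.map⁺ (All.map (Sum.map (raise _) (raise _)) fresh)

      cut⁺ : Cut d (column i , ρ) (List.map edge D)
      cut⁺ x b pr with behind⁻ d end b
      ... | j , refl , b′ = cut j b′ (present⁻ pr)
    confined⇒cops-win {r = r} {D} (move cs′ sts (inj₂ (inj₂ (int , w)))) =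
      Outer.move (Vec.map cell cs′) (steps⁺ sts) (inj₂ robber)
      where
      robber : ∀ r′ D′ → Outer.RobberMove (List.map edge D) (cell r) r′ D′ → Outer.CopsWin (Vec.map cell cs′) r′ D′
      robber _ _ Outer.stay = confined⇒cops-win (w r D Inner.stay)
      robber r′ _ (Outer.go p) with adjacent⁻ int (proj₁ p)
      ... | v , refl = confined⇒cops-win (w v ((r , v) ∷ D) (Inner.go (present⁻ p)))

-- The placement of the cops.

module _ {n : ℕ} where
  open Game (Grid2 n)

  left-end-guarded : ∀ {c x} ρ (e : Fin 4) b → suc (toℕ e + b) ≡ n → toℕ c ≡ toℕ e → toℕ x ≤ toℕ c →
                     CopsWin ((c , zero) ∷ []) (x , ρ) []
  left-end-guarded {x = x} ρ e b fits c≡e x≤c =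
    let i , x≡i = column-surjective z≤n (s≤s (subst (toℕ x ≤_) c≡e x≤c)) in
    subst₂ (λ y z → CopsWin ((y , zero) ∷ []) (z , ρ) [])
      (toℕ-injective (trans (toℕ-column _) (trans (toℕ-fromℕ _) (sym c≡e)))) (sym x≡i)
      (confined⇒cops-win (closed-behind rightward) (closed-behind-flush rightward refl) (left-confined e i ρ))
    where open Window {n} {suc (toℕ e)} 0 b fits

  right-end-guarded : ∀ {c x} ρ (e : Fin 4) → toℕ c + (suc (toℕ e) + 0) ≡ n → toℕ c ≤ toℕ x →
                      CopsWin ((c , zero) ∷ []) (x , ρ) []
  right-end-guarded {c} {x} ρ e fits c≤x =
    let i , x≡i = column-surjective c≤x (subst (toℕ x <_)
                    (trans (sym fits) (cong (toℕ c +_) (+-identityʳ (suc (toℕ e))))) (toℕ<n x)) in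
    subst₂ (λ y z → CopsWin ((y , zero) ∷ []) (z , ρ) [])
      (toℕ-injective (trans (toℕ-column zero) (+-identityʳ _))) (sym x≡i)
      (confined⇒cops-win (closed-behind leftward) (closed-behind-flush leftward refl) (right-confined e i ρ))
    where open Window {n} {suc (toℕ e)} (toℕ c) 0 fits

  gap-guarded : ∀ {c c′ x} ρ (g : Fin 9) b → toℕ c + (suc (suc (toℕ g)) + b) ≡ n → toℕ c′ ≡ toℕ c + suc (toℕ g) →
                toℕ c ≤ toℕ x → toℕ x ≤ toℕ c′ → CopsWin ((c , zero) ∷ (c′ , zero) ∷ []) (x , ρ) []
  gap-guarded {c} {c′} {x} ρ g b fits c′≡ c≤x x≤c′ =
    let i , x≡i = column-surjective c≤x (subst (toℕ x <_) (sym (+-suc _ _)) (s≤s (subst (toℕ x ≤_) c′≡ x≤c′)))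
        c≡  = toℕ-injective (trans (toℕ-column zero) (+-identityʳ _))
        c′≡ = toℕ-injective (trans (toℕ-column _) (trans (cong (toℕ c +_) (toℕ-fromℕ _)) (sym c′≡))) in
    subst₂ (λ (y , y′) z → CopsWin ((y , zero) ∷ (y′ , zero) ∷ []) (z , ρ) [])
      (cong₂ _,_ c≡ c′≡) (sym x≡i)
      (confined⇒cops-win open-ended open-ended-flush (gap-confined g i ρ))
    where open Window {n} {suc (suc (toℕ g))} (toℕ c) b fits

  -- The first argument is the column of the cop preceding the listed ones.
  data Spaced : ∀ {k} → Fin n → Vec (Cell n) k → Set where
    last : ∀ {c} → n ≤ toℕ c + 4 → Spaced c []
    next : ∀ {k c c′} {cs : Vec (Cell n) k} → toℕ c′ ≤ toℕ c + 9 → Spaced c′ cs → Spaced c ((c′ , zero) ∷ cs)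

  -- If the robber starts at or beyond the next cop, the first cop is dropped; otherwise he is in
  -- the gap between these two. Cops that coincide in the last column fall under the first case.
  spaced-guards : ∀ {k c x} ρ {cs : Vec (Cell n) k} → Spaced c cs → toℕ c ≤ toℕ x →
                  CopsWin ((c , zero) ∷ cs) (x , ρ) []
  spaced-guards {c = c} ρ (last n≤c+4) c≤x with m≤n⇒∃[o]m+o≡n (toℕ<n c)
  ... | e , 1+c+e≡n = right-end-guarded ρ (fromℕ< e<4) fits c≤x
    where
    e<4 : e < 4
    e<4 = +-cancelˡ-< (toℕ c) e 4 (subst (_≤ toℕ c + 4) (sym 1+c+e≡n) n≤c+4)
    fits : toℕ c + (suc (toℕ (fromℕ< e<4)) + 0) ≡ n
    fits rewrite toℕ-fromℕ< e<4 | +-identityʳ e = trans (+-suc (toℕ c) e) 1+c+e≡n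
  spaced-guards {c = c} {x} ρ (next {c′ = c′} {cs} c′≤c+9 spaced) c≤x with <-≤-connex (toℕ x) (toℕ c′)
  ... | inj₂ c′≤x = Cops.more-cops (Grid2 n) (skip (⊑-refl _)) (spaced-guards ρ spaced c′≤x)
  ... | inj₁ x<c′ with m≤n⇒∃[o]m+o≡n (≤-<-trans c≤x x<c′) | m≤n⇒∃[o]m+o≡n (toℕ<n c′)
  ... | g , 1+c+g≡c′ | b , 1+c′+b≡n = Cops.more-cops (Grid2 n) (keep (keep ([]⊑ cs)))
          (gap-guarded ρ (fromℕ< g<9) b fits c′≡ c≤x (<⇒≤ x<c′))
    where
    g<9 : g < 9
    g<9 = +-cancelˡ-< (toℕ c) g 9 (subst (_≤ toℕ c + 9) (sym 1+c+g≡c′) c′≤c+9)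
    c′≡ : toℕ c′ ≡ toℕ c + suc (toℕ (fromℕ< g<9))
    c′≡ rewrite toℕ-fromℕ< g<9 = trans (sym 1+c+g≡c′) (sym (+-suc (toℕ c) g))
    fits : toℕ c + (suc (suc (toℕ (fromℕ< g<9))) + b) ≡ n
    fits = begin
      toℕ c + suc (suc (toℕ (fromℕ< g<9)) + b)   ≡⟨ +-suc (toℕ c) _ ⟩
      suc (toℕ c + (suc (toℕ (fromℕ< g<9)) + b)) ≡⟨ cong suc (+-assoc (toℕ c) _ b) ⟨
      suc (toℕ c + suc (toℕ (fromℕ< g<9)) + b)   ≡⟨ cong (λ y → suc (y + b)) c′≡ ⟨
      suc (toℕ c′ + b)                           ≡⟨ 1+c′+b≡n ⟩
      n                                          ∎
      where open ≡-Reasoning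

module _ {n : ℕ} where
  open Game (Grid2 (suc n))

  fromℕ⊓ : ℕ → Fin (suc n)
  fromℕ⊓ s = fromℕ< (s≤s (m⊓n≤n s n))

  toℕ-fromℕ⊓ : ∀ s → toℕ (fromℕ⊓ s) ≡ s ⊓ n
  toℕ-fromℕ⊓ s = toℕ-fromℕ< (s≤s (m⊓n≤n s n))

  -- Clamping is harmless: a cop moved back to the last column `n` satisfies the bound for any `t`.
  reach : ∀ s t → suc n ≤ s + (t + 4) → suc n ≤ toℕ (fromℕ⊓ s) + (t + 4)
  reach s t le rewrite toℕ-fromℕ⊓ s with ⊓-sel s n
  ... | inj₁ eq rewrite eq = le
  ... | inj₂ eq rewrite eq | +-comm t 4 | +-suc n (3 + t) = s≤s (m≤m+n n _)

  place : ∀ k (c : Fin (suc n)) → suc n ≤ toℕ c + (k * 9 + 4) → ∃ λ (cs : Vec (Cell (suc n)) k) → Spaced c cs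
  place zero    c le = [] , last le
  place (suc k) c le with place k (fromℕ⊓ (toℕ c + 9))
    (reach (toℕ c + 9) (k * 9) (subst (suc n ≤_) (sym (+-assoc (toℕ c) 9 (k * 9 + 4))) le))
  ... | cs , spaced = _ , next (subst (_≤ toℕ c + 9) (sym (toℕ-fromℕ⊓ (toℕ c + 9))) (m⊓n≤m _ n)) spaced

  -- Three columns before the first cop, its own, nine for each further cop and three after the last
  -- make `k * 9 + 7`.
  cops-can-win : ∀ k → suc n ≤ 3 + (k * 9 + 4) → CopsCanWin (suc k)
  cops-can-win k le with place k (fromℕ⊓ 3) (reach 3 (k * 9) le)
  ... | cs , spaced = (fromℕ⊓ 3 , zero) ∷ cs , λ (x , ρ) → guards x ρ (≤-total (toℕ (fromℕ⊓ 3)) (toℕ x))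
    where
    guards : ∀ x ρ → _ → CopsWin ((fromℕ⊓ 3 , zero) ∷ cs) (x , ρ) []
    guards x ρ (inj₁ c≤x) = spaced-guards ρ spaced c≤x
    guards x ρ (inj₂ x≤c) with m≤n⇒∃[o]m+o≡n (toℕ<n (fromℕ⊓ 3))
    ... | b , fits = Cops.more-cops (Grid2 (suc n)) (keep ([]⊑ cs))
            (left-end-guarded ρ (fromℕ< c<4) b (trans (cong (λ y → suc (y + b)) (toℕ-fromℕ< c<4)) fits)
              (sym (toℕ-fromℕ< c<4)) x≤c)
      where
      c<4 : toℕ (fromℕ⊓ 3) < 4
      c<4 = s≤s (subst (_≤ 3) (sym (toℕ-fromℕ⊓ 3)) (m⊓n≤m 3 n))

-- Escapes of the robber within a window.

module Flood {W : ℕ} (closed : Closed) where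
  open Game (Grid2 W)
  open ListDec (_≟ᶜ_ {W}) using () renaming (_∈?_ to _∈ˡ?_)

  -- S lists cells that no cop can occupy; u cannot be entered by a cop in one move.
  Sheltered : Deleted → List (Cell W) → Cell W → Set
  Sheltered D S u = Interior closed (proj₁ u) × (∀ i ρ → Present D (i , ρ) u → (i , ρ) ∈ S)

  sheltered? : ∀ D S u → Dec (Sheltered D S u)
  sheltered? D S u =
    interior? closed (proj₁ u) ×-dec all? λ i → all? λ ρ → present? D (i , ρ) u →-dec ((i , ρ) ∈ˡ? S)

  shrink : Deleted → List (Cell W) → List (Cell W)
  shrink D S = filter (sheltered? D S) S

  -- Each `run` is a round: the cops' move shrinks `S`, and the robber's old and new cells must both
  -- survive it. Being sheltered by the empty list means that every edge at `r` is burnt.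
  data Escape : List (Cell W) → Cell W → Deleted → Set where
    isolated : ∀ {S r D} → r ∈ S → Sheltered D [] r → Escape S r D
    run      : ∀ {S r D r′} → r ∈ shrink D S → Present D r r′ → r′ ∈ shrink D S →
               Escape (shrink D S) r′ ((r , r′) ∷ D) → Escape S r D

  escape? : List (Cell W) → ∀ S r D → Maybe (Escape S r D)
  escape? []       S r D = Maybe.zipWith isolated (dec⇒maybe (r ∈ˡ? S)) (dec⇒maybe (sheltered? D [] r))
  escape? (v ∷ vs) S r D =
    Maybe.zipWith (λ (p , q , s) e → run p q s e)
      (dec⇒maybe ((r ∈ˡ? shrink D S) ×-dec present? D r v ×-dec (v ∈ˡ? shrink D S)))
      (escape? vs (shrink D S) v ((r , v) ∷ D))

  cells-except : Cell W → List (Cell W)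
  cells-except u = filter (λ v → ¬? (v ≟ᶜ u)) (cartesianProduct (allFin W) (allFin 2))

module Evasion {n W : ℕ} (a b : ℕ) (fits : a + (W + b) ≡ n) (closed : Closed)
               (flush : ∀ d → T (closed d) → Window.margin a b fits d ≡ 0) where
  open Window a b fits
  open Flood {W} closed

  Avoids : ∀ {k} → Vec (Cell n) k → List (Cell W) → Set
  Avoids cs S = ∀ {u} → u ∈ S → ¬ cell u Vec.∈ cs

  -- A cop now at `u` either stood there already or came over a present edge from a cell of `S`.
  sheltered-avoids : ∀ {k D S u} {cs cs′ : Vec (Cell n) k} → Pointwise (Outer.Step (List.map edge D)) cs cs′ →
                     Avoids cs S → ¬ cell u Vec.∈ cs → Sheltered D S u → ¬ cell u Vec.∈ cs′
  sheltered-avoids sts av u∉ (int , nbs) u∈ with Cops.origin (Grid2 n) sts u∈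
  ... | _ , c∈ , inj₁ refl = u∉ c∈
  ... | _ , c∈ , inj₂ p with adjacent⁻ closed flush int (proj₁ (present-sym p))
  ... | w , refl = av (nbs _ _ (present⁻ p)) c∈

  shrink-avoids : ∀ {k D S} {cs cs′ : Vec (Cell n) k} → Pointwise (Outer.Step (List.map edge D)) cs cs′ →
                  Avoids cs S → Avoids cs′ (shrink D S)
  shrink-avoids {D = D} {S} sts av u∈ with ∈-filter⁻ (sheltered? D S) {xs = S} u∈
  ... | u∈S , sheltered = sheltered-avoids sts av (av u∈S) sheltered

  except-avoids : ∀ {k e ρ} {cs : Vec (Cell n) k} → (∀ {i σ} → i ≢ e → ¬ cell (i , σ) Vec.∈ cs) →
                  ¬ cell (e , ρ) Vec.∈ cs → Avoids cs (cells-except (e , opposite ρ))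
  except-avoids {e = e} {ρ} off on {i , σ} u∈ with proj₂ (∈-filter⁻ (λ v → ¬? (v ≟ᶜ (e , opposite ρ))) {xs = cartesianProduct (allFin W) (allFin 2)} u∈) | i Fin.≟ e | σ Fin.≟ ρ
  ... | _  | no i≢e   | _        = off i≢e
  ... | _  | yes refl | yes refl = on
  ... | u≢ | yes refl | no σ≢ρ   = ⊥-elim (u≢ (cong (i ,_) (other σ≢ρ)))
    where
    other : ∀ {σ ρ : Fin 2} → σ ≢ ρ → σ ≡ opposite ρ
    other {zero}     {zero}     ne = ⊥-elim (ne refl)
    other {zero}     {suc zero} ne = refl
    other {suc zero} {zero}     ne = refl
    other {suc zero} {suc zero} ne = ⊥-elim (ne refl)

  -- The robber stays put forever, against any supposed cop win.
  isolated-safe : ∀ {k D r} {cs : Vec (Cell n) k} → Sheltered D [] r → ¬ cell r Vec.∈ cs →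
                  ¬ Outer.CopsWin cs (cell r) (List.map edge D)
  isolated-safe sh r∉ (Outer.caught r∈) = r∉ r∈
  isolated-safe sh r∉ (Outer.move cs′ sts outcome) with sheltered-avoids {S = []} sts (λ ()) r∉ sh
  isolated-safe sh r∉ (Outer.move cs′ sts (inj₁ r∈)) | r∉′ = r∉′ r∈
  isolated-safe sh r∉ (Outer.move cs′ sts (inj₂ w))  | r∉′ = isolated-safe sh r∉′ (w _ _ Outer.stay)

  escape-safe : ∀ {k D S r} {cs : Vec (Cell n) k} → Escape S r D → Avoids cs S →
                ¬ Outer.CopsWin cs (cell r) (List.map edge D)
  escape-safe (isolated r∈S sh) av w = isolated-safe sh (av r∈S) w
  escape-safe {D = D} {S} (run r∈ p r′∈ e) av (Outer.caught c) = av (proj₁ (∈-filter⁻ (sheltered? D S) {xs = S} r∈)) c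
  escape-safe (run r∈ p r′∈ e) av (Outer.move cs′ sts (inj₁ c)) = shrink-avoids sts av r∈ c
  escape-safe (run r∈ p r′∈ e) av (Outer.move cs′ sts (inj₂ w)) =
    escape-safe e (shrink-avoids sts av) (w _ _ (Outer.go (present⁺ p)))

-- The robber goes once round the square at the end of the grid, back to his corner, and burns both
-- its edges.
left-escape : ∀ (ρ : Fin 2) →
  Flood.Escape {5} (closed-behind rightward) (Flood.cells-except {5} (closed-behind rightward) (# 4 , opposite ρ))
    (# 0 , opposite ρ) []
left-escape = to-witness-T (everywhere λ ρ → let σ = opposite ρ in
  Flood.escape? _ ((# 1 , σ) ∷ (# 1 , ρ) ∷ (# 0 , ρ) ∷ (# 0 , σ) ∷ []) _ _ []) _

right-escape : ∀ (ρ : Fin 2) →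
  Flood.Escape {5} (closed-behind leftward) (Flood.cells-except {5} (closed-behind leftward) (# 0 , opposite ρ))
    (# 4 , opposite ρ) []
right-escape = to-witness-T (everywhere λ ρ → let σ = opposite ρ in
  Flood.escape? _ ((# 3 , σ) ∷ (# 3 , ρ) ∷ (# 4 , ρ) ∷ (# 4 , σ) ∷ []) _ _ []) _

-- Without a corner a third edge must be burnt: the robber enters column 6 from column 7 and then
-- goes once round the square of columns 6 and 5.
gap-escape : ∀ (ρ : Fin 2) →
  Flood.Escape {10} open-ended (Flood.cells-except {10} open-ended (# 9 , opposite ρ)) (# 7 , opposite ρ) []
gap-escape = to-witness-T (everywhere λ ρ → let σ = opposite ρ in
  Flood.escape? _ ((# 6 , σ) ∷ (# 6 , ρ) ∷ (# 5 , ρ) ∷ (# 5 , σ) ∷ (# 6 , σ) ∷ []) _ _ []) _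

-- Counting cops column by column.

count-mono : ∀ {A : Set} {P Q : A → Set} (P? : ∀ x → Dec (P x)) (Q? : ∀ x → Dec (Q x)) → (∀ {x} → P x → Q x) →
             ∀ {k} (xs : Vec A k) → count P? xs ≤ count Q? xs
count-mono P? Q? P⇒Q []       = z≤n
count-mono P? Q? P⇒Q (x ∷ xs) with P? x | Q? x
... | yes p | yes q = s≤s (count-mono P? Q? P⇒Q xs)
... | yes p | no ¬q = ⊥-elim (¬q (P⇒Q p))
... | no ¬p | yes q = m≤n⇒m≤1+n (count-mono P? Q? P⇒Q xs)
... | no ¬p | no ¬q = count-mono P? Q? P⇒Q xs

count-strict : ∀ {A : Set} {P Q : A → Set} (P? : ∀ x → Dec (P x)) (Q? : ∀ x → Dec (Q x)) → (∀ {x} → P x → Q x) →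
               ∀ {k y} {xs : Vec A k} → y Vec.∈ xs → ¬ P y → Q y → count P? xs < count Q? xs
count-strict P? Q? P⇒Q {y = y} {xs = _ ∷ xs} (here refl) ¬Py Qy with P? y | Q? y
... | yes p | _     = ⊥-elim (¬Py p)
... | no _  | yes q = s≤s (count-mono P? Q? P⇒Q xs)
... | no _  | no ¬q = ⊥-elim (¬q Qy)
count-strict P? Q? P⇒Q {xs = x ∷ _} (there y∈) ¬Py Qy with P? x | Q? x
... | yes p | yes q = s≤s (count-strict P? Q? P⇒Q y∈ ¬Py Qy)
... | yes p | no ¬q = ⊥-elim (¬q (P⇒Q p))
... | no ¬p | yes q = m≤n⇒m≤1+n (count-strict P? Q? P⇒Q y∈ ¬Py Qy)
... | no ¬p | no ¬q = count-strict P? Q? P⇒Q y∈ ¬Py Qy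

module RobberStrategy {n k : ℕ} (cs : Vec (Cell n) k) where
  open Game (Grid2 n)
  open VecDec (_≟ᶜ_ {n}) using () renaming (_∈?_ to _∈ᶜ?_)

  RobberSafe : Set
  RobberSafe = ∃ λ r → ¬ CopsWin cs r []

  Free : Fin n → Fin 2 → Set
  Free x σ = ¬ (x , σ) Vec.∈ cs

  left-safe : ∀ ρ → 5 ≤ n → (∀ {x σ} → toℕ x < 4 → Free x σ) → (∀ {x} → toℕ x ≡ 4 → Free x ρ) → RobberSafe
  left-safe ρ 5≤n off on with m≤n⇒∃[o]m+o≡n 5≤n
  ... | b , fits = _ , escape-safe (left-escape ρ) (except-avoids
            (λ {i} i≢4 → off (subst (_< 4) (sym (toℕ-column i))
              (≤∧≢⇒< (s≤s⁻¹ (toℕ<n i)) (i≢4 ∘ toℕ-injective))))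
            (on (toℕ-column (# 4))))
    where
    open Window {n} {5} 0 b fits
    open Evasion 0 b fits (closed-behind rightward) (closed-behind-flush rightward refl)

  right-safe : ∀ ρ a → a + 5 ≡ n → (∀ {x σ} → a < toℕ x → Free x σ) → (∀ {x} → toℕ x ≡ a → Free x ρ) → RobberSafe
  right-safe ρ a fits off on =
    _ , escape-safe (right-escape ρ) (except-avoids
            (λ {i} i≢0 → off (subst (a <_) (sym (toℕ-column i))
              (m<m+n a (n≢0⇒n>0 (i≢0 ∘ toℕ-injective)))))
            (on (trans (toℕ-column (# 0)) (+-identityʳ a))))
    where
    open Window {n} {5} a 0 fits
    open Evasion a 0 fits (closed-behind leftward) (closed-behind-flush leftward refl)

  gap-safe : ∀ ρ p → p + 10 < n → (∀ {x σ} → p < toℕ x → toℕ x < p + 10 → Free x σ) →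
             (∀ {x} → toℕ x ≡ p + 10 → Free x ρ) → RobberSafe
  gap-safe ρ p p+10<n off on with m≤n⇒∃[o]m+o≡n p+10<n
  ... | b , eq = _ , escape-safe (gap-escape ρ) (except-avoids
            (λ {i} i≢9 → off (subst (p <_) (sym (toℕ-column i)) (s≤s (m≤m+n p (toℕ i))))
              (subst₂ _<_ (sym (toℕ-column i)) (sym (+-suc p 9))
                (s≤s (+-monoʳ-< p (≤∧≢⇒< (s≤s⁻¹ (toℕ<n i)) (i≢9 ∘ toℕ-injective))))))
            (on (trans (toℕ-column (# 9)) (sym (+-suc p 9)))))
    where
    fits : suc p + (10 + b) ≡ n
    fits = trans (cong suc (sym (+-assoc p 10 b))) eq
    open Window {n} {10} (suc p) b fits
    open Evasion (suc p) b fits open-ended open-ended-flush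

  vacant-safe : ∀ {r D} {ds : Vec (Cell n) k} → (∀ {v} → ¬ v Vec.∈ ds) → ¬ CopsWin ds r D
  vacant-safe vacant (caught p) = vacant p
  vacant-safe vacant (move ds′ sts (inj₁ p)) = vacant (proj₁ (proj₂ (Cops.origin (Grid2 n) sts p)))
  vacant-safe vacant (move ds′ sts (inj₂ w)) =
    vacant-safe (λ p → vacant (proj₁ (proj₂ (Cops.origin (Grid2 n) sts p)))) (w _ _ stay)

  -- Two cops in the same column are separated by their ranks, so that both are counted.
  rank : Cell n → ℕ
  rank (x , σ) = toℕ σ + toℕ x * 2

  cops-below : ℕ → ℕ
  cops-below m = count (λ v → rank v <? m) cs

  below-mono : ∀ m → cops-below m ≤ cops-below (suc m)
  below-mono m = count-mono (λ v → rank v <? m) (λ v → rank v <? suc m) m<n⇒m<1+n cs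

  below-strict : ∀ {v} → v Vec.∈ cs → cops-below (rank v) < cops-below (suc (rank v))
  below-strict {v} v∈ = count-strict (λ u → rank u <? rank v) (λ u → rank u <? suc (rank v)) m<n⇒m<1+n v∈ (<-irrefl refl) ≤-refl

  -- The cells before column `j` are exactly those of rank below `j * 2`.
  cops-left-of : ℕ → ℕ
  cops-left-of j = cops-below (j * 2)

  data Column (x : Fin n) : Set where
    empty  : (∀ {σ} → Free x σ) → Column x
    single : ∀ ρ → Free x ρ → 1 + cops-left-of (toℕ x) ≤ cops-left-of (suc (toℕ x)) → Column x
    double : 2 + cops-left-of (toℕ x) ≤ cops-left-of (suc (toℕ x)) → Column x

  -- The two cells of column `x` have the ranks `toℕ x * 2` and its successor, so the count passes
  -- the column in two steps, each strict where a cop stands.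
  column : ∀ x → Column x
  column x with (x , zero) ∈ᶜ? cs | (x , suc zero) ∈ᶜ? cs
  ... | no ∉₀ | no ∉₁ = empty λ { {zero} → ∉₀ ; {suc zero} → ∉₁ }
  ... | yes ∈₀ | no ∉₁ = single (suc zero) ∉₁ (≤-trans (below-strict ∈₀) (below-mono _))
  ... | no ∉₀ | yes ∈₁ = single zero ∉₀ (≤-trans (s≤s (below-mono _)) (below-strict ∈₁))
  ... | yes ∈₀ | yes ∈₁ = double (≤-trans (s≤s (below-strict ∈₀)) (below-strict ∈₁))

  regroup : ∀ p c → p + c + 6 ≡ c + (p + 6)
  regroup = solve-∀

  -- In front, p is the last occupied column, or the one after it if both its cells are occupied.  The
  -- bound says that the p + 5 columns up to p + 4, and one more for the left end, are paid for at a
  -- rate of nine columns per cop.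
  data Swept (j : ℕ) : Set where
    bare  : (∀ {x σ} → toℕ x < j → Free x σ) → Swept j
    front : ∀ p ρ → (∀ {x σ} → p < toℕ x → toℕ x < j → Free x σ) → (∀ {x} → toℕ x ≡ p → toℕ x < j → Free x ρ) →
            p + 6 ≤ cops-left-of j * 9 → Swept j

  below-suc : ∀ {x y : Fin n} → toℕ y < suc (toℕ x) → toℕ y < toℕ x ⊎ y ≡ x
  below-suc y<1+x = Sum.map₂ toℕ-injective (m≤n⇒m<n∨m≡n (s≤s⁻¹ y<1+x))

  extend : ∀ {x} {P : Fin n → Set} → (∀ {y} → toℕ y < toℕ x → P y) → P x → ∀ {y} → toℕ y < suc (toℕ x) → P y
  extend below at y<1+x with below-suc y<1+x
  ... | inj₁ y<x  = below y<x
  ... | inj₂ refl = at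

  front-single : ∀ {x ρ} → Free x ρ → toℕ x + 6 ≤ cops-left-of (suc (toℕ x)) * 9 → Swept (suc (toℕ x))
  front-single {x} {ρ} x-free = front (toℕ x) ρ
    (λ x<y y<1+x → ⊥-elim (<⇒≱ y<1+x x<y))
    (λ y≡x _ → subst (λ z → Free z ρ) (sym (toℕ-injective y≡x)) x-free)

  -- Column `x` has no free cell to offer, so the front is set one column further on, which is not
  -- swept yet.
  front-double : ∀ {x : Fin n} → suc (toℕ x) + 6 ≤ cops-left-of (suc (toℕ x)) * 9 → Swept (suc (toℕ x))
  front-double {x} = front (suc (toℕ x)) zero
    (λ x<y y<1+x → ⊥-elim (<-asym y<1+x x<y))
    (λ y≡1+x y<1+x → ⊥-elim (<-irrefl y≡1+x y<1+x))

  -- A cop too far beyond the front, or beyond the left end, leaves room for an escape before it.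
  -- Otherwise the front advances by at most 9 for a single cop, or 11 for two cops, who pay for 18.
  sweep-column : ∀ x → Swept (toℕ x) → RobberSafe ⊎ Swept (suc (toℕ x))
  sweep-column x (bare free) with column x
  ... | empty x-free = inj₂ (bare λ {y} {σ} → extend {P = λ z → Free z σ} free x-free)
  ... | single ρ x-free more with <-≤-connex (toℕ x) 4
  -- At most 3 + 6 = 9, paid by the first cop.
  ...   | inj₁ x<4 = inj₂ (front-single x-free
            (≤-trans (+-monoˡ-≤ 6 (s≤s⁻¹ x<4)) (*-monoˡ-≤ 9 (≤-trans (s≤s z≤n) more))))
  ...   | inj₂ 4≤x = inj₁ (left-safe ρ (≤-<-trans 4≤x (toℕ<n x)) (λ y<4 → free (<-≤-trans y<4 4≤x))
            (λ y≡4 → extend {P = λ z → Free z ρ} free x-free (s≤s (subst (_≤ toℕ x) (sym y≡4) 4≤x))))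
  sweep-column x (bare free) | double more with <-≤-connex (toℕ x) 5
  ...   | inj₁ x<5 = inj₂ (front-double
            (≤-trans (+-monoˡ-≤ 6 x<5) (≤-trans (m≤m+n 11 7) (*-monoˡ-≤ 9 (≤-trans (s≤s (s≤s z≤n)) more)))))
  ...   | inj₂ 5≤x = inj₁ (left-safe zero (≤-trans 5≤x (<⇒≤ (toℕ<n x))) (λ y<4 → free (<-≤-trans (m<n⇒m<1+n y<4) 5≤x))
            (λ y≡4 → free (subst (_< toℕ x) (sym y≡4) 5≤x)))
  sweep-column x (front p ρ off on reach) with column x
  ... | empty x-free = inj₂ (front p ρ
          (λ {y} {σ} p<y y<1+x →
            extend {P = λ z → p < toℕ z → Free z σ} (λ z<x p<z → off p<z z<x) (λ _ → x-free) y<1+x p<y)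
          (λ y≡p y<1+x →
            extend {P = λ z → toℕ z ≡ p → Free z ρ} (λ z<x z≡p → on z≡p z<x) (λ _ → x-free) y<1+x y≡p)
          (≤-trans reach (*-monoˡ-≤ 9 (≤-trans (below-mono _) (below-mono _)))))
  ... | single ρ′ x-free more with <-≤-connex (toℕ x) (p + 10)
  ...   | inj₁ x<p+10 = inj₂ (front-single x-free (begin
            toℕ x + 6                         ≤⟨ +-monoˡ-≤ 6 (s≤s⁻¹ (subst (toℕ x <_) (+-suc p 9) x<p+10)) ⟩
            p + 9 + 6                         ≡⟨ regroup p 9 ⟩
            9 + (p + 6)                       ≤⟨ +-monoʳ-≤ 9 reach ⟩
            9 + cops-left-of (toℕ x) * 9      ≤⟨ *-monoˡ-≤ 9 more ⟩
            cops-left-of (suc (toℕ x)) * 9    ∎))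
    where open ≤-Reasoning
  ...   | inj₂ p+10≤x = inj₁ (gap-safe ρ′ p (≤-<-trans p+10≤x (toℕ<n x))
            (λ p<y y<p+10 → off p<y (<-≤-trans y<p+10 p+10≤x))
            (λ y≡p+10 → extend {P = λ z → p < toℕ z → Free z ρ′} (λ z<x p<z → off p<z z<x) (λ _ → x-free)
              (s≤s (subst (_≤ toℕ x) (sym y≡p+10) p+10≤x)) (subst (p <_) (sym y≡p+10) (m<m+n p z<s))))
  sweep-column x (front p ρ off on reach) | double more with <-≤-connex (toℕ x) (p + 11)
  ...   | inj₁ x<p+11 = inj₂ (front-double (begin
            suc (toℕ x) + 6                   ≤⟨ +-monoˡ-≤ 6 x<p+11 ⟩
            p + 11 + 6                        ≡⟨ regroup p 11 ⟩
            11 + (p + 6)                      ≤⟨ m≤n+m _ 7 ⟩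
            18 + (p + 6)                      ≤⟨ +-monoʳ-≤ 18 reach ⟩
            18 + cops-left-of (toℕ x) * 9     ≤⟨ *-monoˡ-≤ 9 more ⟩
            cops-left-of (suc (toℕ x)) * 9    ∎))
    where open ≤-Reasoning
  ...   | inj₂ p+11≤x = inj₁ (gap-safe zero p (<-trans p+10<x (toℕ<n x))
            (λ p<y y<p+10 → off p<y (<-trans y<p+10 p+10<x))
            (λ y≡p+10 → off (subst (p <_) (sym y≡p+10) (m<m+n p z<s)) (subst (_< toℕ x) (sym y≡p+10) p+10<x)))
    where
    p+10<x : p + 10 < toℕ x
    p+10<x = subst (_≤ toℕ x) (+-suc p 10) p+11≤x

  sweep : ∀ j → j ≤ n → RobberSafe ⊎ Swept j
  sweep zero    _   = inj₂ (bare λ ())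
  sweep (suc j) j<n with sweep j (<⇒≤ j<n)
  ... | inj₁ safe  = inj₁ safe
  ... | inj₂ swept = subst (λ i → RobberSafe ⊎ Swept (suc i)) (toℕ-fromℕ< j<n)
          (sweep-column (fromℕ< j<n) (subst Swept (sym (toℕ-fromℕ< j<n)) swept))

  robber-safe : 1 ≤ n → k * 9 ≤ suc n → RobberSafe
  robber-safe 1≤n few with sweep n ≤-refl
  ... | inj₁ safe        = safe
  -- No cell holds a cop, which is the case of an empty team.
  ... | inj₂ (bare free) = (fromℕ< 1≤n , zero) , vacant-safe λ {v} → free (toℕ<n (proj₁ v))
  ... | inj₂ (front p ρ off on reach) with <-≤-connex n (p + 5)
  ...   | inj₁ n<p+5 = ⊥-elim (<⇒≱ (n<1+n (suc n)) (begin
            2 + n              ≤⟨ s≤s n<p+5 ⟩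
            suc (p + 5)        ≡⟨ +-suc p 5 ⟨
            p + 6              ≤⟨ reach ⟩
            cops-left-of n * 9 ≤⟨ *-monoˡ-≤ 9 (count≤n (λ v → rank v <? n * 2) cs) ⟩
            k * 9              ≤⟨ few ⟩
            suc n              ∎))
    where open ≤-Reasoning
  ...   | inj₂ p+5≤n with m≤n⇒∃[o]m+o≡n p+5≤n
  -- The last five columns begin at `p + o`. If `o` is zero this is column `p` with its free cell
  -- `ρ`; otherwise it lies in the empty part beyond `p`.
  ...     | o , eq = right-safe ρ (p + o) (trans (swap-last p o 5) eq)
              (λ p+o<x → off (≤-<-trans (m≤m+n p o) p+o<x) (toℕ<n _))
              (λ {x} x≡p+o → boundary x (m≤n⇒m<n∨m≡n (subst (p ≤_) (sym x≡p+o) (m≤m+n p o))))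
    where
    swap-last : ∀ a b c → a + b + c ≡ a + c + b
    swap-last = solve-∀

    boundary : ∀ x → p < toℕ x ⊎ p ≡ toℕ x → Free x ρ
    boundary x (inj₁ p<x) = off p<x (toℕ<n x)
    boundary x (inj₂ p≡x) = on (sym p≡x) (toℕ<n x)

-- The arithmetic of the ceiling.

-- The hypotheses make `q` the quotient of `suc n + 2 + 8` by 9, which is the ceiling. For N columns
-- they give N + 2 ≤ 9q, enough for q cops, and 9k ≤ N + 1 for each k < q, too few for k cops.
cop-number : ∀ n q → suc n + 2 + 8 < 9 + q * 9 → q * 9 ≤ suc n + 2 + 8 → BridgeBurningCopNumber (Grid2 (suc n)) q
cop-number n zero    upper lower = ⊥-elim (<⇒≱ upper (≤-trans (m≤n+m 9 (suc n + 1)) (≤-reflexive (tidy n))))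
  where
  tidy : ∀ n → suc n + 1 + 9 ≡ suc n + 2 + 8
  tidy = solve-∀
cop-number n (suc q) upper lower = cops-can-win q enough , λ k k<q (cs , w) →
  let r , safe = RobberStrategy.robber-safe {suc n} cs (s≤s z≤n) (too-few k k<q) in safe (w r)
  where
  enough : suc n ≤ 3 + (q * 9 + 4)
  enough = +-cancelˡ-≤ 11 _ _ (subst₂ _≤_ (tidy n) (tidy′ q) upper)
    where
    tidy : ∀ n → suc (suc n + 2 + 8) ≡ 11 + suc n
    tidy = solve-∀
    tidy′ : ∀ q → 9 + (9 + q * 9) ≡ 11 + (3 + (q * 9 + 4))
    tidy′ = solve-∀

  too-few : ∀ k → k < suc q → k * 9 ≤ suc (suc n)
  too-few k k<1+q = +-cancelˡ-≤ 9 _ _ (≤-trans (*-monoˡ-≤ 9 k<1+q) (≤-trans lower (≤-reflexive (tidy n))))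
    where
    tidy : ∀ n → suc n + 2 + 8 ≡ 9 + suc (suc n)
    tidy = solve-∀

theorem4p3 : ∀ (n : ℕ) → n ≥ 1 →
    BridgeBurningCopNumber (Grid2 n) ⌈ n + 2 /suc 8 ⌉
theorem4p3 (suc n) _ = cop-number n _
  (subst (_< 9 + m / 9 * 9) (sym (m≡m%n+[m/n]*n m 9)) (+-monoˡ-< (m / 9 * 9) (m%n<n m 9)))
  (m/n*n≤m m 9)
  where
  m : ℕ
  m = suc n + 2 + 8
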